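{- Let $H$ be a graph and $v$ a vertex of $H$. Then $(H,v)$ is neutral for the glue operator if and only if $o(H)=\mathcal N$ and $o(H\setminus\{v\})=\mathcal D$.
   Context: The Maker-Breaker domination game on a graph: Dominator and Staller alternately choose a not-yet-chosen vertex (no passing), starting with all vertices unchosen; when all vertices are chosen, Dominator wins if his vertices form a dominating set of the graph, otherwise Staller wins. The outcome $o(\cdot)$ is $\mathcal D$ if Dominator has a winning strategy both as first and as second player, $\mathcal S$ if Staller has a winning strategy both as first and as second player, and $\mathcal N$ if the first player has a winning strategy; every graph has one of these outcomes. For disjoint graphs $G,H$ and vertices $u\in V(G)$, $v\in V(H)$, the glued graph $G\odot_{u,v}H$ has vertex set $(V(G)\setminus\{u\})\cup(V(H)\setminus\{v\})\cup\{w\}$ for a new vertex $w$, with $xy$ an edge iff $xy$ is an edge of $G$ or of $H$, or $y=w$ and $xu\in E(G)$ or $xv\in E(H)$ (i.e., $u$ and $v$ are identified into $w$). The pair $(H,v)$ is neutral for the glue operator if for every graph $G$ and every vertex $u$ of $G$, $o(G\odot_{u,v}H)=o(G)$. $H\setminus\{v\}$ denotes the graph obtained from $H$ by deleting $v$. -}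

module Defs where

open import Data.Bool using (Bool; true; false)
import Data.Bool.Properties as Bool
open import Data.Empty using (⊥; ⊥-elim)
open import Data.Fin using (Fin; zero; suc; punchIn; splitAt)
open import Data.Fin.Properties using (_≟_; all?; any?)
open import Data.Maybe using (Maybe; just; nothing)
open import Data.Nat using (ℕ; zero; suc; _+_)
open import Data.Nat.Properties using (suc-injective)
open import Data.Product using (∃; _×_; _,_; proj₁; proj₂)
open import Data.Sum using (_⊎_; inj₁; inj₂; swap)
open import Data.Vec using (Vec; []; _∷_; lookup; replicate; _[_]≔_)
open import Data.Vec.Properties using (lookup∘updateAt; lookup∘updateAt′; []≔-commutes)
open import Function using (_∘_)
open import Relation.Binary.PropositionalEquality
open import Relation.Nullary using (¬_; Dec; yes; no; contradiction; _×-dec_; _⊎-dec_)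

record Graph (n : ℕ) : Set where
  field
    adj        : Fin n → Fin n → Bool
    adj-sym    : ∀ x y → adj x y ≡ adj y x
    adj-irrefl : ∀ x → adj x x ≡ false

  Adj : Fin n → Fin n → Set
  Adj x y = adj x y ≡ true

open Graph public using (adj; Adj)

-- `punchIn v` enumerates the vertices different from v.
delete : ∀ {n} → Graph (suc n) → Fin (suc n) → Graph n
delete H v = record
  { adj        = λ x y → adj H (punchIn v x) (punchIn v y)
  ; adj-sym    = λ x y → Graph.adj-sym H (punchIn v x) (punchIn v y)
  ; adj-irrefl = λ x → Graph.adj-irrefl H (punchIn v x)
  }

-- Vertex zero of the glued graph is the new vertex w; a vertex suc i stands
-- for a vertex of G other than u or a vertex of H other than v, according
-- to `splitAt m i`.
module Glue {m n} (G : Graph (suc m)) (u : Fin (suc m))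
                  (H : Graph (suc n)) (v : Fin (suc n)) where

  adj-w : Fin m ⊎ Fin n → Bool
  adj-w (inj₁ x) = adj G u (punchIn u x)
  adj-w (inj₂ y) = adj H v (punchIn v y)

  adj-old : Fin m ⊎ Fin n → Fin m ⊎ Fin n → Bool
  adj-old (inj₁ x) (inj₁ x′) = adj G (punchIn u x) (punchIn u x′)
  adj-old (inj₂ y) (inj₂ y′) = adj H (punchIn v y) (punchIn v y′)
  adj-old (inj₁ _) (inj₂ _)  = false
  adj-old (inj₂ _) (inj₁ _)  = false

  adj-glue : Fin (suc (m + n)) → Fin (suc (m + n)) → Bool
  adj-glue zero    zero    = false
  adj-glue zero    (suc j) = adj-w (splitAt m j)
  adj-glue (suc i) zero    = adj-w (splitAt m i)
  adj-glue (suc i) (suc j) = adj-old (splitAt m i) (splitAt m j)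

  adj-old-sym : ∀ a b → adj-old a b ≡ adj-old b a
  adj-old-sym (inj₁ x) (inj₁ x′) = Graph.adj-sym G _ _
  adj-old-sym (inj₂ y) (inj₂ y′) = Graph.adj-sym H _ _
  adj-old-sym (inj₁ _) (inj₂ _)  = refl
  adj-old-sym (inj₂ _) (inj₁ _)  = refl

  adj-old-irrefl : ∀ a → adj-old a a ≡ false
  adj-old-irrefl (inj₁ x) = Graph.adj-irrefl G _
  adj-old-irrefl (inj₂ y) = Graph.adj-irrefl H _

  adj-glue-sym : ∀ i j → adj-glue i j ≡ adj-glue j i
  adj-glue-sym zero    zero    = refl
  adj-glue-sym zero    (suc j) = refl
  adj-glue-sym (suc i) zero    = refl
  adj-glue-sym (suc i) (suc j) = adj-old-sym (splitAt m i) (splitAt m j)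

  adj-glue-irrefl : ∀ i → adj-glue i i ≡ false
  adj-glue-irrefl zero    = refl
  adj-glue-irrefl (suc i) = adj-old-irrefl (splitAt m i)

glue : ∀ {m n} → Graph (suc m) → Fin (suc m) → Graph (suc n) → Fin (suc n) →
       Graph (suc (m + n))
glue G u H v = record
  { adj        = adj-glue
  ; adj-sym    = adj-glue-sym
  ; adj-irrefl = adj-glue-irrefl
  }
  where open Glue G u H v

data Player : Set where
  dominator staller : Player

opponent : Player → Player
opponent dominator = staller
opponent staller   = dominator

-- The entry at x is the player who has chosen x, if any.
Position : ℕ → Set
Position n = Vec (Maybe Player) n

start : ∀ {n} → Position n
start = replicate _ nothing

Unchosen : ∀ {n} → Position n → Fin n → Set
Unchosen pos x = lookup pos x ≡ nothing

Full : ∀ {n} → Position n → Set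
Full pos = ∀ x → ¬ Unchosen pos x

choose : ∀ {n} → Position n → Fin n → Player → Position n
choose pos x p = pos [ x ]≔ just p

Dominating : ∀ {n} → Graph n → (Fin n → Set) → Set
Dominating G D = ∀ x → ∃ λ y → D y × (y ≡ x ⊎ Adj G y x)

ChosenBy : ∀ {n} → Player → Position n → Fin n → Set
ChosenBy p pos x = lookup pos x ≡ just p

Wins : ∀ {n} → Graph n → Player → Position n → Set
Wins G dominator pos = Dominating G (ChosenBy dominator pos)
Wins G staller   pos = ¬ Dominating G (ChosenBy dominator pos)

-- WinningStrategy G p q pos: strategy trees with which p wins from pos when
-- q is to move.  The witness in `reply` excludes positions in which the
-- opponent cannot move because the game is over.
data WinningStrategy {n} (G : Graph n) (p : Player) : Player → Position n → Set where
  over  : ∀ {q pos} → Full pos → Wins G p pos → WinningStrategy G p q pos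
  move  : ∀ {pos} x → Unchosen pos x →
          WinningStrategy G p (opponent p) (choose pos x p) →
          WinningStrategy G p p pos
  reply : ∀ {pos} → ∃ (Unchosen pos) →
          (∀ x → Unchosen pos x → WinningStrategy G p p (choose pos x (opponent p))) →
          WinningStrategy G p (opponent p) pos

data Outcome : Set where
  𝒟 𝒮 𝒩 : Outcome

-- The argument q is the player who moves first.
HasOutcome : ∀ {n} → Graph n → Outcome → Set
HasOutcome G 𝒟 = ∀ q → WinningStrategy G dominator q start
HasOutcome G 𝒮 = ∀ q → WinningStrategy G staller q start
HasOutcome G 𝒩 = ∀ q → WinningStrategy G q q start

unchosen? : ∀ {n} (pos : Position n) x → Dec (Unchosen pos x)
unchosen? pos x with lookup pos x
... | nothing = yes refl
... | just _  = no λ ()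

chosenByDominator? : ∀ {n} (pos : Position n) x → Dec (ChosenBy dominator pos x)
chosenByDominator? pos x with lookup pos x
... | nothing          = no λ ()
... | just dominator   = yes refl
... | just staller     = no λ ()

dominating? : ∀ {n} (G : Graph n) pos → Dec (Dominating G (ChosenBy dominator pos))
dominating? G pos = all? λ x → any? λ y →
  chosenByDominator? pos y ×-dec (y ≟ x ⊎-dec (adj G y x Bool.≟ true))

choose-same : ∀ {n} (pos : Position n) x p → lookup (choose pos x p) x ≡ just p
choose-same pos x p = lookup∘updateAt x pos

choose-other : ∀ {n} (pos : Position n) {x y} p → y ≢ x →
               lookup (choose pos x p) y ≡ lookup pos y
choose-other pos {x} {y} p y≢x = lookup∘updateAt′ y x y≢x pos

choose-comm : ∀ {n} (pos : Position n) {x y} p q → x ≢ y →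
              choose (choose pos x p) y q ≡ choose (choose pos y q) x p
choose-comm pos {x} {y} p q x≢y = []≔-commutes pos x y x≢y

unchosen≢ : ∀ {n} (pos : Position n) {x y} p → Unchosen (choose pos x p) y → y ≢ x
unchosen≢ pos {x} p uy refl with () ← trans (sym (choose-same pos x p)) uy

unchosen-before : ∀ {n} (pos : Position n) {x y} p →
                  Unchosen (choose pos x p) y → Unchosen pos y
unchosen-before pos p uy = trans (sym (choose-other pos p (unchosen≢ pos p uy))) uy

unchosen-after : ∀ {n} (pos : Position n) {x y} p → y ≢ x →
                 Unchosen pos y → Unchosen (choose pos x p) y
unchosen-after pos p y≢x uy = trans (choose-other pos p y≢x) uy

module _ {n} (G : Graph n) where

  full⇒wins : ∀ {p q pos} → Full pos → WinningStrategy G p q pos → Wins G p pos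
  full⇒wins full (over _ w)         = w
  full⇒wins full (move x ux _)      = contradiction ux (full x)
  full⇒wins full (reply (x , ux) _) = contradiction ux (full x)

  dominating-mono : ∀ pos x → Dominating G (ChosenBy dominator (choose pos x staller)) →
                    Dominating G (ChosenBy dominator (choose pos x dominator))
  dominating-mono pos x dom z with dom z
  ... | y , cy , near with y ≟ x
  ...   | yes refl = y , choose-same pos y dominator , near
  ...   | no y≢x   = y , trans (choose-other pos dominator y≢x)
                               (trans (sym (choose-other pos staller y≢x)) cy) , near

  wins-mono : ∀ p pos x → Wins G p (choose pos x (opponent p)) → Wins G p (choose pos x p)
  wins-mono dominator pos x w = dominating-mono pos x w
  wins-mono staller   pos x w = w ∘ dominating-mono pos x

  mutual
    extra-vertex : ∀ {p q pos} x → Unchosen pos x → WinningStrategy G p q pos →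
                   WinningStrategy G p q (choose pos x p)
    extra-vertex x ux (over full _) = contradiction ux (full x)
    extra-vertex {p} {pos = pos} x ux (move y uy s) with x ≟ y
    ... | yes refl = extra-move s
    ... | no x≢y   = move y (unchosen-after pos p (x≢y ∘ sym) uy)
                       (subst (WinningStrategy G p _) (choose-comm pos p p (x≢y ∘ sym))
                         (extra-vertex x (unchosen-after pos p x≢y ux) s))
    extra-vertex {p} {pos = pos} x ux (reply _ f) with any? (unchosen? (choose pos x p))
    ... | no none = over (λ y uy → none (y , uy))
                      (wins-mono p pos x (full⇒wins full (f x ux)))
      where
      full : Full (choose pos x (opponent p))
      full y uy = none (y , unchosen-after pos p (unchosen≢ pos (opponent p) uy)
                              (unchosen-before pos (opponent p) uy))
    ... | yes some = reply some λ y uy →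
          let y≢x = unchosen≢ pos p uy in
          subst (WinningStrategy G p p) (choose-comm pos (opponent p) p y≢x)
            (extra-vertex x (unchosen-after pos (opponent p) (y≢x ∘ sym) ux)
              (f y (unchosen-before pos p uy)))

    extra-move : ∀ {p pos} → WinningStrategy G p (opponent p) pos → WinningStrategy G p p pos
    extra-move {p} {pos} s with any? (unchosen? pos)
    ... | yes (x , ux) = move x ux (extra-vertex x ux s)
    ... | no none      = let full = λ x ux → none (x , ux) in over full (full⇒wins full s)

  not-both : ∀ {q pos} → WinningStrategy G dominator q pos → WinningStrategy G staller q pos → ⊥
  not-both (over full w)      t                  = full⇒wins full t w
  not-both s@(move _ _ _)     (over full w)      = w (full⇒wins full s)
  not-both s@(reply _ _)      (over full w)      = w (full⇒wins full s)
  not-both (move x ux s)      (reply _ g)        = not-both s (g x ux)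
  not-both (reply _ f)        (move x ux t)      = not-both (f x ux) t

#unchosen : ∀ {n} → Position n → ℕ
#unchosen []              = 0
#unchosen (nothing ∷ pos) = suc (#unchosen pos)
#unchosen (just _ ∷ pos)  = #unchosen pos

#unchosen-choose : ∀ {n} (pos : Position n) x p → Unchosen pos x →
                   #unchosen pos ≡ suc (#unchosen (choose pos x p))
#unchosen-choose (nothing ∷ pos) zero    p ux = refl
#unchosen-choose (nothing ∷ pos) (suc x) p ux = cong suc (#unchosen-choose pos x p ux)
#unchosen-choose (just _ ∷ pos)  (suc x) p ux = #unchosen-choose pos x p ux

search : ∀ {n} {P Q : Fin n → Set} → (∀ x → P x ⊎ Q x) → ∃ P ⊎ (∀ x → Q x)
search {zero}  f = inj₂ λ ()
search {suc n} f with f zero | search (f ∘ suc)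
... | inj₁ p | _            = inj₁ (zero , p)
... | inj₂ q | inj₁ (x , p) = inj₁ (suc x , p)
... | inj₂ q | inj₂ qs      = inj₂ λ { zero → q ; (suc x) → qs x }

module _ {n} (G : Graph n) where

  Determined : Player → Position n → Set
  Determined q pos = WinningStrategy G dominator q pos ⊎ WinningStrategy G staller q pos

  determined : ∀ k q pos → #unchosen pos ≡ k → Determined q pos
  determined k q pos eq with any? (unchosen? pos)
  determined k q pos eq | no none with dominating? G pos
  ... | yes d = inj₁ (over (λ x ux → none (x , ux)) d)
  ... | no ¬d = inj₂ (over (λ x ux → none (x , ux)) ¬d)
  determined zero q pos eq | yes (x , ux)
    with () ← trans (sym eq) (#unchosen-choose pos x q ux)
  determined (suc k) q pos eq | yes some = step q
    where
    next : ∀ p x → Unchosen pos x → Determined (opponent p) (choose pos x p)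
    next p x ux = determined k (opponent p) (choose pos x p)
                    (suc-injective (trans (sym (#unchosen-choose pos x p ux)) eq))

    options : ∀ p {A B : Position n → Set} →
              (∀ x → Unchosen pos x → A (choose pos x p) ⊎ B (choose pos x p)) →
              (∃ λ x → Unchosen pos x × A (choose pos x p)) ⊎
              (∀ x → Unchosen pos x → B (choose pos x p))
    options p {A} {B} f = search split
      where
      split : ∀ x → (Unchosen pos x × A (choose pos x p)) ⊎ (Unchosen pos x → B (choose pos x p))
      split x with unchosen? pos x
      ... | no ¬ux = inj₂ λ ux → contradiction ux ¬ux
      ... | yes ux with f x ux
      ...   | inj₁ a = inj₁ (ux , a)
      ...   | inj₂ b = inj₂ λ _ → b

    step : ∀ q → Determined q pos
    step dominator with options dominator {WinningStrategy G dominator staller} {WinningStrategy G staller staller} (next dominator)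
    ... | inj₁ (x , ux , s) = inj₁ (move x ux s)
    ... | inj₂ f            = inj₂ (reply some f)
    step staller with options staller {WinningStrategy G staller dominator} {WinningStrategy G dominator dominator} (λ x ux → swap (next staller x ux))
    ... | inj₁ (x , ux , s) = inj₂ (move x ux s)
    ... | inj₂ f            = inj₁ (reply some f)

  outcome-exists : ∃ (HasOutcome G)
  outcome-exists with determined _ dominator start refl | determined _ staller start refl
  ... | inj₁ s | inj₁ t = 𝒟 , λ { dominator → s ; staller → t }
  ... | inj₁ s | inj₂ t = 𝒩 , λ { dominator → s ; staller → t }
  ... | inj₂ s | inj₂ t = 𝒮 , λ { dominator → s ; staller → t }
  ... | inj₂ s | inj₁ t = ⊥-elim (not-both G (extra-move G t) s)

  outcome-unique : ∀ o o′ → HasOutcome G o → HasOutcome G o′ → o ≡ o′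
  outcome-unique 𝒟 𝒟 s t = refl
  outcome-unique 𝒟 𝒮 s t = ⊥-elim (not-both G (s dominator) (t dominator))
  outcome-unique 𝒟 𝒩 s t = ⊥-elim (not-both G (s staller) (t staller))
  outcome-unique 𝒮 𝒟 s t = ⊥-elim (not-both G (t dominator) (s dominator))
  outcome-unique 𝒮 𝒮 s t = refl
  outcome-unique 𝒮 𝒩 s t = ⊥-elim (not-both G (t dominator) (s dominator))
  outcome-unique 𝒩 𝒟 s t = ⊥-elim (not-both G (t staller) (s staller))
  outcome-unique 𝒩 𝒮 s t = ⊥-elim (not-both G (s dominator) (t dominator))
  outcome-unique 𝒩 𝒩 s t = refl

outcome : ∀ {n} → Graph n → Outcome
outcome G = proj₁ (outcome-exists G)

outcome-correct : ∀ {n} (G : Graph n) → HasOutcome G (outcome G)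
outcome-correct G = proj₂ (outcome-exists G)

Neutral : ∀ {n} → Graph (suc n) → Fin (suc n) → Set
Neutral H v = ∀ m (G : Graph (suc m)) (u : Fin (suc m)) →
              outcome (glue G u H v) ≡ outcome G

{-# OPTIONS --safe #-}
module Submission where

-- Sufficiency.  Dominator plays a winning strategy on G and, independently, one
-- as second player on H ∖ v.  Staller, when to move, follows a winning strategy
-- on H as long as Dominator answers in H ∖ v.  If Dominator answers elsewhere,
-- Staller continues as if v had been answered and isolates a vertex of H outside
-- N[v].  If the strategy asks for v itself, Staller turns to G, pretending to own
-- v in H: if the vertex won in G is u, then the pretence is true, and N[u] in G
-- together with the win in H yields an undominated vertex.  If Staller wins G as
-- second player and Dominator starts in H, Staller plays on G as if Dominator had
-- chosen u.
--
-- Necessity.  Glue a single vertex (outcome 𝒩) and a single edge (outcome 𝒟).  In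
-- the latter case Staller takes w, which forces Dominator onto the leaf, and then
-- plays first on H ∖ v.

open import Data.Bool using (true; false)
open import Data.Empty using (⊥-elim)
open import Data.Nat using (ℕ; zero; suc; _+_)
open import Data.Nat.Properties using (suc-injective)
open import Data.Fin using (Fin; zero; suc; punchIn; punchOut; splitAt; _↑ˡ_; _↑ʳ_)
open import Data.Fin.Properties using (_≟_; any?; punchIn-injective; punchInᵢ≢i; punchIn-punchOut; splitAt-↑ˡ; splitAt-↑ʳ; splitAt⁻¹-↑ˡ; splitAt⁻¹-↑ʳ)
open import Data.Maybe using (Maybe; just; nothing)
open import Data.Product using (∃; _×_; _,_)
open import Data.Sum using (_⊎_; inj₁; inj₂; [_,_]′) renaming (map to map⊎)
open import Data.Sum.Properties using (inj₁-injective; inj₂-injective)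
open import Data.Unit using (⊤; tt)
open import Data.Vec using (lookup; []; _∷_)
open import Data.Vec.Properties using (lookup-replicate)
open import Function using (_∘_; id)
open import Function.Bundles using (_⇔_; mk⇔)
open import Relation.Binary.PropositionalEquality using (_≡_; _≢_; refl; sym; trans; cong; subst)
open import Relation.Nullary using (¬_; yes; no; contradiction)
open import Defs

private variable
  a b k m n N : ℕ
  p : Player

-- Strategies with passes and arbitrary goals.

data Role : Set where
  mine theirs : Role

-- Strategy trees for p with an arbitrary goal W, in which p is also allowed
-- to pass; on graphs, passes are eliminated by `extra-move`.
data Plan {n} (W : Position n → Set) (p : Player) : Role → Position n → Set where
  move  : ∀ {pos} x → Unchosen pos x → Plan W p theirs (choose pos x p) → Plan W p mine pos
  pass  : ∀ {pos} → Plan W p theirs pos → Plan W p mine pos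
  reply : ∀ {pos} → (Full pos → W pos) →
          (∀ x → Unchosen pos x → Plan W p mine (choose pos x (opponent p))) →
          Plan W p theirs pos

-- Plans are indexed by roles because an index `opponent p` does not unify for a variable `p`,
-- whereas `mine` and `theirs` can be matched on without splitting on the player.
role : Player → Player → Role
role dominator dominator = mine
role dominator staller   = theirs
role staller   dominator = theirs
role staller   staller   = mine

turn : Player → Role → Player
turn p mine   = p
turn p theirs = opponent p

turn-role : ∀ p q → turn p (role p q) ≡ q
turn-role dominator dominator = refl
turn-role dominator staller   = refl
turn-role staller   dominator = refl
turn-role staller   staller   = refl

full-plan : ∀ {W : Position n → Set} {pos} r → Full pos → W pos → Plan W p r pos
full-plan theirs full w = reply (λ _ → w) λ x ux → contradiction ux (full x)
-- The goal is tested only at `reply`, so a player to move on a full board passes first.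
full-plan mine   full w = pass (full-plan theirs full w)

strategy⇒plan : ∀ {G : Graph n} p {q pos} → WinningStrategy G p q pos → Plan (Wins G p) p (role p q) pos
strategy⇒plan p         (over full w) = full-plan _ full w
strategy⇒plan dominator (move x ux s) = move x ux (strategy⇒plan dominator s)
strategy⇒plan staller   (move x ux s) = move x ux (strategy⇒plan staller s)
strategy⇒plan dominator (reply (x , ux) f) =
  reply (λ full → contradiction ux (full x)) λ y uy → strategy⇒plan dominator (f y uy)
strategy⇒plan staller   (reply (x , ux) f) =
  reply (λ full → contradiction ux (full x)) λ y uy → strategy⇒plan staller (f y uy)

plan⇒strategy : ∀ {G : Graph n} {r pos} → Plan (Wins G p) p r pos → WinningStrategy G p (turn p r) pos
plan⇒strategy         (move x ux s) = move x ux (plan⇒strategy s)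
plan⇒strategy {G = G} (pass s)      = extra-move G (plan⇒strategy s)
plan⇒strategy {pos = pos} (reply w f) with any? (unchosen? pos)
... | yes some = reply some λ x ux → plan⇒strategy (f x ux)
... | no none  = let full = λ x ux → none (x , ux) in over full (w full)

goal : ∀ {W : Position n → Set} {pos} → Plan W p theirs pos → Full pos → W pos
goal (reply w _) = w

-- Always passing is enough on a board whose result does not matter. The number `k` of unchosen
-- vertices makes the recursion structural.
idle : ∀ k (pos : Position n) → #unchosen pos ≡ k → Plan (λ _ → ⊤) p theirs pos
idle {p = p} k pos eq = reply (λ _ → tt) λ x ux → pass (after k x ux eq)
  where
  after : ∀ k x → Unchosen pos x → #unchosen pos ≡ k →
          Plan (λ _ → ⊤) p theirs (choose pos x (opponent p))
  after zero    x ux eq with () ← trans (sym eq) (#unchosen-choose pos x p ux)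
  after (suc k) x ux eq =
    idle k _ (suc-injective (trans (sym (#unchosen-choose pos x (opponent p) ux)) eq))

map-plan : ∀ {W W′ : Position n → Set} → (∀ pos → W pos → W′ pos) →
           ∀ {r pos} → Plan W p r pos → Plan W′ p r pos
map-plan h (move x ux s) = move x ux (map-plan h s)
map-plan h (pass s)      = pass (map-plan h s)
map-plan h (reply w f)   = reply (h _ ∘ w) λ x ux → map-plan h (f x ux)

chosen-stays : ∀ (pos : Position n) {x y q} r → Unchosen pos x →
               ChosenBy q pos y → ChosenBy q (choose pos x r) y
chosen-stays pos {x} {y} r ux cy with y ≟ x
... | yes refl with () ← trans (sym ux) cy
... | no y≢x   = trans (choose-other pos r y≢x) cy

-- A choice is never undone, so the owner of a vertex may be added to the goal. This carries the
-- ownership of `u`, `v` or a leaf to the end of the game.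
remember : ∀ {W : Position n → Set} {q x r pos} → ChosenBy q pos x → Plan W p r pos →
           Plan (λ pos → W pos × ChosenBy q pos x) p r pos
remember {pos = pos} c (move y uy s) = move y uy (remember (chosen-stays pos _ uy c) s)
remember             c (pass s)      = pass (remember c s)
remember {pos = pos} c (reply w f)   =
  reply (λ full → w full , c) λ y uy → remember (chosen-stays pos _ uy c) (f y uy)

-- Playing on two boards at once.

module Combine (α : Fin N → Fin a ⊎ Fin b) (α-injective : ∀ {i j} → α i ≡ α j → i ≡ j) where

  value : Position a → Position b → Fin a ⊎ Fin b → Maybe Player
  value g h = [ lookup g , lookup h ]′

  -- α need not be surjective: it may miss vertices that are already chosen.
  record Reads (g : Position a) (h : Position b) (c : Position N) : Set where
    field lookup-value : ∀ i → lookup c i ≡ value g h (α i)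

  -- This makes every move planned on a component board playable on the joint board, and lets
  -- fullness pass from the joint board to both components.
  record Located (g : Position a) (h : Position b) : Set where
    field locate : ∀ z → value g h z ≡ nothing → ∃ λ i → α i ≡ z

  open Reads public
  open Located public

  module _ {g : Position a} {h : Position b} where

    located-chooseˡ : ∀ {x q} → Located g h → Located (choose g x q) h
    located-chooseˡ l .locate (inj₁ y) uy = locate l (inj₁ y) (unchosen-before g _ uy)
    located-chooseˡ l .locate (inj₂ y) uy = locate l (inj₂ y) uy

    located-chooseʳ : ∀ {y q} → Located g h → Located g (choose h y q)
    located-chooseʳ l .locate (inj₁ x) ux = locate l (inj₁ x) ux
    located-chooseʳ l .locate (inj₂ x) ux = locate l (inj₂ x) (unchosen-before h _ ux)

  module _ {g : Position a} {h : Position b} {c : Position N} where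

    reads-at : Reads g h c → ∀ {i z} → α i ≡ z → lookup c i ≡ value g h z
    reads-at r {i} refl = lookup-value r i

    reads-chooseˡ : Reads g h c → ∀ {i x} q → α i ≡ inj₁ x →
                    Reads (choose g x q) h (choose c i q)
    reads-chooseˡ r {i} {x} q αi .lookup-value j with j ≟ i
    ... | yes refl rewrite αi = trans (choose-same c j q) (sym (choose-same g x q))
    ... | no j≢i with α j in αj
    ...   | inj₁ y = trans (choose-other c q j≢i) (trans (reads-at r αj) (sym (choose-other g q y≢x)))
      where
      y≢x : y ≢ x
      y≢x refl = j≢i (α-injective (trans αj (sym αi)))
    ...   | inj₂ y = trans (choose-other c q j≢i) (reads-at r αj)

    reads-chooseʳ : Reads g h c → ∀ {i y} q → α i ≡ inj₂ y →
                    Reads g (choose h y q) (choose c i q)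
    reads-chooseʳ r {i} {y} q αi .lookup-value j with j ≟ i
    ... | yes refl rewrite αi = trans (choose-same c j q) (sym (choose-same h y q))
    ... | no j≢i with α j in αj
    ...   | inj₁ x = trans (choose-other c q j≢i) (reads-at r αj)
    ...   | inj₂ x = trans (choose-other c q j≢i) (trans (reads-at r αj) (sym (choose-other h q x≢y)))
      where
      x≢y : x ≢ y
      x≢y refl = j≢i (α-injective (trans αj (sym αi)))

    full-value : Located g h → Reads g h c → Full c → ∀ z → value g h z ≢ nothing
    full-value l r full z uz with locate l z uz
    ... | i , αi = full i (trans (reads-at r αi) uz)

  module _ {WA : Position a → Set} {WB : Position b → Set} {WK : Position N → Set}
           (final : ∀ {g h c} → Reads g h c → WA g → WB h → WK c) where

    -- Each move of the opponent is answered on the board where it fell, so at most one component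
    -- plan is ever on move. A pass there becomes a pass on the joint board.
    combine  : ∀ {g h c} → Located g h → Reads g h c →
               Plan WA p theirs g → Plan WB p theirs h → Plan WK p theirs c
    combineˡ : ∀ {g h c} → Located g h → Reads g h c →
               Plan WA p mine g → Plan WB p theirs h → Plan WK p mine c
    combineʳ : ∀ {g h c} → Located g h → Reads g h c →
               Plan WA p theirs g → Plan WB p mine h → Plan WK p mine c

    -- The value `α i` enters as a separate `z` with an equation, so that it can be matched on while
    -- `c` and its reading stay as they are.
    respond  : ∀ {g h c} → Located g h → Reads g h c →
               Plan WA p theirs g → Plan WB p theirs h →
               ∀ {i} z → α i ≡ z → Unchosen c i → Plan WK p mine (choose c i (opponent p))

    combine l r s t =
      reply (λ full → final r (goal s (full-value l r full ∘ inj₁)) (goal t (full-value l r full ∘ inj₂)))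
            (λ i ui → respond l r s t (α i) refl ui)

    respond l r (reply _ f) t (inj₁ x) αi ui =
      combineˡ (located-chooseˡ l) (reads-chooseˡ r _ αi) (f x (trans (sym (reads-at r αi)) ui)) t
    respond l r s (reply _ f) (inj₂ y) αi ui =
      combineʳ (located-chooseʳ l) (reads-chooseʳ r _ αi) s (f y (trans (sym (reads-at r αi)) ui))

    combineˡ l r (pass s)      t = pass (combine l r s t)
    combineˡ l r (move x ux s) t with locate l (inj₁ x) ux
    ... | i , αi = move i (trans (reads-at r αi) ux)
                     (combine (located-chooseˡ l) (reads-chooseˡ r _ αi) s t)

    combineʳ l r s (pass t)      = pass (combine l r s t)
    combineʳ l r s (move y uy t) with locate l (inj₂ y) uy
    ... | i , αi = move i (trans (reads-at r αi) uy)
                     (combine (located-chooseʳ l) (reads-chooseʳ r _ αi) s t)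

-- The two sides of a glued graph.

data View (l : Fin (suc k)) : Fin (suc k) → Set where
  same  : View l l
  other : ∀ x → View l (punchIn l x)

view : (l x : Fin (suc k)) → View l x
view l x with l ≟ x
... | yes refl = same
... | no l≢x   = subst (View l) (punchIn-punchOut l≢x) (other (punchOut l≢x))

DominatedAt : Graph n → Position n → Fin n → Set
DominatedAt G pos x = ∃ λ y → ChosenBy dominator pos y × (y ≡ x ⊎ Adj G y x)

-- The part of a glued graph K that comes from L, with l identified to zero.
record Side (K : Graph (suc N)) (L : Graph (suc k)) (l : Fin (suc k)) : Set where
  field
    old     : Fin k → Fin N
    adj-new : ∀ x → adj K zero (suc (old x)) ≡ adj L l (punchIn l x)
    adj-old : ∀ x y → adj K (suc (old x)) (suc (old y)) ≡ adj L (punchIn l x) (punchIn l y)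
    closed  : ∀ i x → Adj K (suc i) (suc (old x)) → ∃ λ y → i ≡ old y

  adj-new′ : ∀ x → adj K (suc (old x)) zero ≡ adj L (punchIn l x) l
  adj-new′ x = trans (Graph.adj-sym K _ _) (trans (adj-new x) (Graph.adj-sym L _ _))

  AgreeOld : Position (suc N) → Position (suc k) → Set
  AgreeOld c g = ∀ x → lookup c (suc (old x)) ≡ lookup g (punchIn l x)

  -- By `closed`, the glued vertex is the only link between the sides: domination comes from it or
  -- from inside `delete L l`.
  dominated-old : ∀ c x → DominatedAt K c (suc (old x)) →
    (ChosenBy dominator c zero × Adj L l (punchIn l x)) ⊎
    (∃ λ y → ChosenBy dominator c (suc (old y)) × (y ≡ x ⊎ Adj (delete L l) y x))
  dominated-old c x (zero  , cy , inj₂ a)    = inj₁ (cy , trans (sym (adj-new x)) a)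
  dominated-old c x (suc i , cy , inj₁ refl) = inj₂ (x , cy , inj₁ refl)
  dominated-old c x (suc i , cy , inj₂ a) with closed i x a
  ... | y , refl = inj₂ (y , cy , inj₂ (trans (sym (adj-old y x)) a))

  -- At the glued vertex an implication suffices instead of equal owners. It therefore also applies
  -- when `l` belongs to Dominator on `g` only by pretence.
  restrict-old : ∀ c g → AgreeOld c g → (ChosenBy dominator c zero → ChosenBy dominator g l) →
                 ∀ x → DominatedAt K c (suc (old x)) → DominatedAt L g (punchIn l x)
  restrict-old c g ag c⇒g x d with dominated-old c x d
  ... | inj₁ (c0 , a)             = l , c⇒g c0 , inj₂ a
  ... | inj₂ (y , cy , inj₁ refl) = punchIn l y , trans (sym (ag y)) cy , inj₁ refl
  ... | inj₂ (y , cy , inj₂ a)    = punchIn l y , trans (sym (ag y)) cy , inj₂ a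

  restrict-delete : ∀ c h → (∀ x → lookup c (suc (old x)) ≡ lookup h x) → ChosenBy staller c zero →
                    ∀ x → DominatedAt K c (suc (old x)) → DominatedAt (delete L l) h x
  restrict-delete c h ag c0 x d with dominated-old c x d
  ... | inj₁ (c0′ , _) with () ← trans (sym c0) c0′
  ... | inj₂ (y , cy , near) = y , trans (sym (ag y)) cy , near

  lift-new : ∀ c g → AgreeOld c g → lookup c zero ≡ lookup g l → DominatedAt L g l → DominatedAt K c zero
  lift-new c g ag eq (y , cy , near) with view l y | near
  ... | same    | _       = zero , trans eq cy , inj₁ refl
  ... | other x | inj₁ x≡l = contradiction x≡l (punchInᵢ≢i l x)
  ... | other x | inj₂ a  = suc (old x) , trans (ag x) cy , inj₂ (trans (adj-new′ x) a)

  lift-old : ∀ c g → AgreeOld c g → lookup c zero ≡ lookup g l →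
             ∀ x → DominatedAt L g (punchIn l x) → DominatedAt K c (suc (old x))
  lift-old c g ag eq x (y , cy , near) with view l y | near
  ... | same    | inj₁ l≡x = contradiction (sym l≡x) (punchInᵢ≢i l x)
  ... | same    | inj₂ a   = zero , trans eq cy , inj₂ (trans (adj-new x) a)
  ... | other z | inj₁ z≡x = suc (old z) , trans (ag z) cy , inj₁ (cong (suc ∘ old) (punchIn-injective l z x z≡x))
  ... | other z | inj₂ a   = suc (old z) , trans (ag z) cy , inj₂ (trans (adj-old z x) a)

  lift-delete : ∀ c h → (∀ x → lookup c (suc (old x)) ≡ lookup h x) →
                ∀ x → DominatedAt (delete L l) h x → DominatedAt K c (suc (old x))
  lift-delete c h ag x (y , cy , inj₁ refl) = suc (old y) , trans (ag y) cy , inj₁ refl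
  lift-delete c h ag x (y , cy , inj₂ a)    = suc (old y) , trans (ag y) cy , inj₂ (trans (adj-old y x) a)

  -- With `l` owned by Dominator on `g`, the vertex left undominated there lies outside the closed
  -- neighbourhood of `l`. Hence it stays undominated in `K`, whoever really owns the glued vertex.
  staller-wins-side : ∀ c g → AgreeOld c g → Wins L staller g × ChosenBy dominator g l → Wins K staller c
  staller-wins-side c g ag (¬dom , gl) dom = ¬dom dominated
    where
    dominated : Dominating L (ChosenBy dominator g)
    dominated y with view l y
    ... | same    = l , gl , inj₁ refl
    ... | other x = restrict-old c g ag (λ _ → gl) x (dom (suc (old x)))

-- Reading the glued board as a pair of boards.

module Junction (w₀ : Fin a ⊎ Fin b) (f : Fin m → Fin a) (g : Fin n → Fin b)
                (f-injective : ∀ {x y} → f x ≡ f y → x ≡ y)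
                (g-injective : ∀ {x y} → g x ≡ g y → x ≡ y)
                (fresh : ∀ z → w₀ ≢ map⊎ f g z) where

  -- The glued vertex is read at `w₀`, on one board only. If the other board has its own copy of
  -- that vertex, `β` misses the copy.
  β : Fin (suc (m + n)) → Fin a ⊎ Fin b
  β zero    = w₀
  β (suc i) = map⊎ f g (splitAt m i)

  β-↑ˡ : ∀ x → β (suc (x ↑ˡ n)) ≡ inj₁ (f x)
  β-↑ˡ x = cong (map⊎ f g) (splitAt-↑ˡ m x n)

  β-↑ʳ : ∀ y → β (suc (m ↑ʳ y)) ≡ inj₂ (g y)
  β-↑ʳ y = cong (map⊎ f g) (splitAt-↑ʳ m n y)

  β-injective : ∀ {i j} → β i ≡ β j → i ≡ j
  β-injective {zero}  {zero}  eq = refl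
  β-injective {zero}  {suc j} eq = contradiction eq (fresh (splitAt m j))
  β-injective {suc i} {zero}  eq = contradiction (sym eq) (fresh (splitAt m i))
  β-injective {suc i} {suc j} eq with splitAt m i in eqi | splitAt m j in eqj
  ... | inj₁ x | inj₁ y = cong suc (trans (sym (splitAt⁻¹-↑ˡ eqi))
          (trans (cong (_↑ˡ n) (f-injective (inj₁-injective eq))) (splitAt⁻¹-↑ˡ eqj)))
  ... | inj₂ x | inj₂ y = cong suc (trans (sym (splitAt⁻¹-↑ʳ eqi))
          (trans (cong (m ↑ʳ_) (g-injective (inj₂-injective eq))) (splitAt⁻¹-↑ʳ eqj)))
  ... | inj₁ _ | inj₂ _ with () ← eq
  ... | inj₂ _ | inj₁ _ with () ← eq

  open Combine β β-injective public

  start-reads : Reads start start start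
  start-reads .lookup-value i with β i
  ... | inj₁ x = trans (lookup-replicate i nothing) (sym (lookup-replicate x nothing))
  ... | inj₂ y = trans (lookup-replicate i nothing) (sym (lookup-replicate y nothing))

fresh-inj₁ : (l : Fin (suc k)) (f : Fin n → Fin b) → ∀ z → inj₁ l ≢ map⊎ (punchIn l) f z
fresh-inj₁ l f (inj₁ x) eq = punchInᵢ≢i l x (sym (inj₁-injective eq))

fresh-inj₂ : (l : Fin (suc k)) (f : Fin m → Fin a) → ∀ z → inj₂ l ≢ map⊎ f (punchIn l) z
fresh-inj₂ l f (inj₂ y) eq = punchInᵢ≢i l y (sym (inj₂-injective eq))

-- Sufficiency: strategies on the glued graph.

module Glued (G : Graph (suc m)) (u : Fin (suc m)) (H : Graph (suc n)) (v : Fin (suc n)) where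

  K : Graph (suc (m + n))
  K = glue G u H v

  sideG : Side K G u
  sideG = record { old = _↑ˡ n ; adj-new = new ; adj-old = old ; closed = closed }
    where
    new : ∀ x → adj K zero (suc (x ↑ˡ n)) ≡ adj G u (punchIn u x)
    new x rewrite splitAt-↑ˡ m x n = refl
    old : ∀ x y → adj K (suc (x ↑ˡ n)) (suc (y ↑ˡ n)) ≡ adj G (punchIn u x) (punchIn u y)
    old x y rewrite splitAt-↑ˡ m x n | splitAt-↑ˡ m y n = refl
    closed : ∀ i x → Adj K (suc i) (suc (x ↑ˡ n)) → ∃ λ y → i ≡ y ↑ˡ n
    closed i x a rewrite splitAt-↑ˡ m x n with splitAt m i in eq
    ... | inj₁ y = y , sym (splitAt⁻¹-↑ˡ eq)
    ... | inj₂ y with () ← a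

  sideH : Side K H v
  sideH = record { old = m ↑ʳ_ ; adj-new = new ; adj-old = old ; closed = closed }
    where
    new : ∀ x → adj K zero (suc (m ↑ʳ x)) ≡ adj H v (punchIn v x)
    new x rewrite splitAt-↑ʳ m n x = refl
    old : ∀ x y → adj K (suc (m ↑ʳ x)) (suc (m ↑ʳ y)) ≡ adj H (punchIn v x) (punchIn v y)
    old x y rewrite splitAt-↑ʳ m n x | splitAt-↑ʳ m n y = refl
    closed : ∀ i x → Adj K (suc i) (suc (m ↑ʳ x)) → ∃ λ y → i ≡ m ↑ʳ y
    closed i x a rewrite splitAt-↑ʳ m n x with splitAt m i in eq
    ... | inj₁ y with () ← a
    ... | inj₂ y = y , sym (splitAt⁻¹-↑ʳ eq)

  module SG = Side sideG
  module SH = Side sideH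

  data Vertex : Fin (suc (m + n)) → Set where
    new  : Vertex zero
    oldG : ∀ x → Vertex (suc (x ↑ˡ n))
    oldH : ∀ y → Vertex (suc (m ↑ʳ y))

  vertex : ∀ i → Vertex i
  vertex zero = new
  vertex (suc i) with splitAt m i in eq
  ... | inj₁ x = subst (Vertex ∘ suc) (splitAt⁻¹-↑ˡ eq) (oldG x)
  ... | inj₂ y = subst (Vertex ∘ suc) (splitAt⁻¹-↑ʳ eq) (oldH y)

  -- In `JD` the second board is `delete H v`, so nothing is missed. `JG` reads the glued vertex as
  -- `u` and misses `v`; `JH` reads it as `v` and misses `u`. A missed vertex can be given to either
  -- player by pretence.
  module JD = Junction (inj₁ u) (punchIn u) (id {A = Fin n}) (punchIn-injective u _ _) id
    (fresh-inj₁ u _)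

  module JG = Junction (inj₁ u) (punchIn u) (punchIn v) (punchIn-injective u _ _) (punchIn-injective v _ _)
    (fresh-inj₁ u _)

  module JH = Junction (inj₂ v) (punchIn u) (punchIn v) (punchIn-injective u _ _) (punchIn-injective v _ _)
    (fresh-inj₂ v _)

  JD-located : ∀ {g h} → JD.Located g h
  JD-located .JD.locate (inj₁ x) _ with view u x
  ... | same    = zero , refl
  ... | other y = suc (y ↑ˡ n) , JD.β-↑ˡ y
  JD-located .JD.locate (inj₂ y) _ = suc (m ↑ʳ y) , JD.β-↑ʳ y

  JG-located : ∀ {g h q} → ChosenBy q h v → JG.Located g h
  JG-located cv .JG.locate (inj₁ x) _ with view u x
  ... | same    = zero , refl
  ... | other y = suc (y ↑ˡ n) , JG.β-↑ˡ y
  JG-located cv .JG.locate (inj₂ y) uy with view v y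
  ... | same with () ← trans (sym cv) uy
  ... | other x = suc (m ↑ʳ x) , JG.β-↑ʳ x

  JH-located : ∀ {g h q} → ChosenBy q g u → JH.Located g h
  JH-located cu .JH.locate (inj₁ x) ux with view u x
  ... | same with () ← trans (sym cu) ux
  ... | other y = suc (y ↑ˡ n) , JH.β-↑ˡ y
  JH-located cu .JH.locate (inj₂ y) _ with view v y
  ... | same    = zero , refl
  ... | other x = suc (m ↑ʳ x) , JH.β-↑ʳ x

  dominates : ∀ {g h c} → JD.Reads g h c → Wins G dominator g → Wins (delete H v) dominator h →
              Wins K dominator c
  dominates {g} {h} {c} r domG domH i with vertex i
  ... | new    = SG.lift-new c g (λ x → JD.reads-at r (JD.β-↑ˡ x)) (JD.lookup-value r zero) (domG u)
  ... | oldG x = SG.lift-old c g (λ x → JD.reads-at r (JD.β-↑ˡ x)) (JD.lookup-value r zero) x (domG (punchIn u x))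
  ... | oldH y = SH.lift-delete c h (λ y → JD.reads-at r (JD.β-↑ʳ y)) y (domH y)

  dominator-wins : ∀ q → WinningStrategy G dominator q start →
                   WinningStrategy (delete H v) dominator staller start →
                   WinningStrategy K dominator q start
  dominator-wins dominator s t = plan⇒strategy
    (JD.combineˡ dominates JD-located JD.start-reads (strategy⇒plan dominator s) (strategy⇒plan dominator t))
  dominator-wins staller s t = plan⇒strategy
    (JD.combine dominates JD-located JD.start-reads (strategy⇒plan dominator s) (strategy⇒plan dominator t))

  -- If `K` were dominated, then so would be `G`. The only doubtful vertex is `u`, when the glued
  -- vertex is not Dominator's and is dominated from the `H` side; but then all of `H` would be
  -- dominated on `h`.
  undominated : ∀ {g h c} → JG.Reads g h c → Wins G staller g →
                Wins H staller h × ChosenBy staller h v → Wins K staller c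
  undominated {g} {h} {c} r ¬domG (¬domH , hv) dom = ¬domG dominatedG
    where
    agreeG : SG.AgreeOld c g
    agreeG x = JG.reads-at r (JG.β-↑ˡ x)

    agreeH : SH.AgreeOld c h
    agreeH y = JG.reads-at r (JG.β-↑ʳ y)

    dominatedH : ¬ ChosenBy dominator c zero → DominatedAt H h v → Dominating H (ChosenBy dominator h)
    dominatedH ¬c0 dv y with view v y
    ... | same    = dv
    ... | other x = SH.restrict-old c h agreeH (λ c0 → contradiction c0 ¬c0) x (dom (suc (m ↑ʳ x)))

    dominated-u : DominatedAt G g u
    dominated-u with chosenByDominator? c zero
    ... | yes c0 = u , trans (sym (JG.lookup-value r zero)) c0 , inj₁ refl
    ... | no ¬c0 with dom zero
    ...   | j , cj , near with vertex j | near
    ...     | new    | _      = contradiction cj ¬c0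
    ...     | oldG x | inj₂ a = punchIn u x , trans (sym (agreeG x)) cj , inj₂ (trans (sym (SG.adj-new′ x)) a)
    ...     | oldH y | inj₂ a = contradiction (dominatedH ¬c0
      (punchIn v y , trans (sym (agreeH y)) cj , inj₂ (trans (sym (SH.adj-new′ y)) a))) ¬domH

    dominatedG : Dominating G (ChosenBy dominator g)
    dominatedG y with view u y
    ... | same    = dominated-u
    ... | other x = SG.restrict-old c g agreeG (trans (sym (JG.lookup-value r zero))) x (dom (suc (x ↑ˡ n)))

  -- No vertex of `K` reads `v`, so choosing `v` on the board of `H` leaves the reading of every
  -- vertex unchanged.
  JG-misses : ∀ i {y} → JG.β i ≡ inj₂ y → v ≢ y
  JG-misses i βi refl with vertex i
  ... | new with () ← βi
  ... | oldG x with () ← trans (sym (JG.β-↑ˡ x)) βi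
  ... | oldH y = punchInᵢ≢i v y (inj₂-injective (trans (sym (JG.β-↑ʳ y)) βi))

  JH-misses : ∀ i {x} → JH.β i ≡ inj₁ x → u ≢ x
  JH-misses i βi refl with vertex i
  ... | new with () ← βi
  ... | oldG x = punchInᵢ≢i u x (inj₁-injective (trans (sym (JH.β-↑ˡ x)) βi))
  ... | oldH y with () ← trans (sym (JH.β-↑ʳ y)) βi

  module _ {g : Position (suc m)} (ug : Unchosen g u) (s : Plan (Wins G staller) staller mine g) where

    -- Invariant: the play so far has left `g` alone, with `u` free and Staller on move there by
    -- `s`, while `v` is still free on `h`.
    opening        : ∀ {h c} → JG.Reads g h c → Unchosen h v → Plan (Wins H staller) staller mine h →
                Plan (Wins K staller) staller mine c
    opening-theirs : ∀ {h c} → JG.Reads g h c → Unchosen h v → Plan (Wins H staller) staller theirs h →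
                Plan (Wins K staller) staller theirs c
    opening-reply  : ∀ {h c} → JG.Reads g h c → Unchosen h v → Plan (Wins H staller) staller theirs h →
                ∀ {i} z → JG.β i ≡ z → Unchosen c i → Plan (Wins K staller) staller mine (choose c i dominator)

    opening r uh (pass t) = pass (opening-theirs r uh t)
    opening {h} r uh (move z uz t) with view v z
    -- Taking `v` by pretence changes nothing in `K`, so Staller still has a turn and spends it on
    -- `G`, following `s`.
    ... | same    = JG.combineˡ undominated (JG-located hv) r′ s (remember hv t)
      where
      hv : ChosenBy staller (choose h v staller) v
      hv = choose-same h v staller
      r′ : JG.Reads g (choose h v staller) _
      r′ .JG.lookup-value i with JG.β i in βi
      ... | inj₁ x = JG.reads-at r βi
      ... | inj₂ y = trans (JG.reads-at r βi) (sym (choose-other h staller (JG-misses i βi ∘ sym)))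
    ... | other y = move (suc (m ↑ʳ y)) (trans (JG.reads-at r (JG.β-↑ʳ y)) uz)
                      (opening-theirs (JG.reads-chooseʳ r staller (JG.β-↑ʳ y))
                        (unchosen-after h staller (punchInᵢ≢i v y ∘ sym) uh) t)

    opening-theirs r uh t =
      -- The glued vertex is read as `u`, which is free, so the game is not over.
      reply (λ full → contradiction (trans (JG.lookup-value r zero) ug) (full zero))
            (λ i ui → opening-reply r uh t (JG.β i) refl ui)

    opening-reply {h} r uh (reply _ f) {i} (inj₂ y) βi ui =
      opening (JG.reads-chooseʳ r dominator βi)
              (unchosen-after h dominator (JG-misses i βi) uh)
              (f y (trans (sym (JG.reads-at r βi)) ui))
    -- A move on the `G` side, possibly at the glued vertex itself, counts as Dominator choosing
    -- `v`. From here on only the board of `H` matters, and the other one is idle.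
    opening-reply {h} r uh (reply _ f) {i} (inj₁ x) βi ui =
      JG.combineʳ (λ {_} {h} {c} r _ → SH.staller-wins-side c h (λ y → JG.reads-at r (JG.β-↑ʳ y)))
        (JG-located hv) r′ (idle _ _ refl) (remember hv (f v uh))
      where
      hv : ChosenBy dominator (choose h v dominator) v
      hv = choose-same h v dominator
      r′ : JG.Reads (choose g x dominator) (choose h v dominator) _
      r′ .JG.lookup-value j with JG.β j in βj | JG.reads-at (JG.reads-chooseˡ r dominator βi) {j} refl
      ... | inj₁ x | eq = eq
      ... | inj₂ y | eq = trans eq (sym (choose-other h dominator (JG-misses j βj ∘ sym)))

  staller-wins-first : WinningStrategy G staller staller start → WinningStrategy H staller staller start →
                       WinningStrategy K staller staller start
  staller-wins-first s t = plan⇒strategy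
    (opening (lookup-replicate u nothing) (strategy⇒plan staller s)
             JG.start-reads (lookup-replicate v nothing) (strategy⇒plan staller t))

  staller-wins-second : WinningStrategy G staller dominator start → WinningStrategy H staller staller start →
                        WinningStrategy K staller dominator start
  staller-wins-second s t with strategy⇒plan staller s
  ... | reply _ f = plan⇒strategy (reply (λ full → contradiction refl (full zero)) λ i _ → answer i)
    where
    gu : ChosenBy dominator (choose start u dominator) u
    gu = choose-same start u dominator

    -- Dominator's move, possibly at the glued vertex, is recorded on the idle board of `H`, while
    -- on `G` Dominator is credited with `u`. A Staller win on `G` then leaves a vertex undominated
    -- outside the closed neighbourhood of `u`.
    ignore-H : ∀ {i y} → JH.β i ≡ inj₂ y → Plan (Wins K staller) staller mine (choose start i dominator)
    ignore-H {i} {y} βi =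
      JH.combineˡ (λ {g} {_} {c} r w _ → SG.staller-wins-side c g (λ x → JH.reads-at r (JH.β-↑ˡ x)) w)
        (JH-located gu) r′ (remember gu (f u (lookup-replicate u nothing))) (idle _ _ refl)
      where
      r′ : JH.Reads (choose start u dominator) (choose start y dominator) (choose start i dominator)
      r′ .JH.lookup-value j with JH.β j in βj | JH.reads-at (JH.reads-chooseʳ JH.start-reads {i} dominator βi) {j} refl
      ... | inj₁ x | eq = trans eq (sym (choose-other start dominator (JH-misses j βj ∘ sym)))
      ... | inj₂ y | eq = eq

    answer : ∀ i → Plan (Wins K staller) staller mine (choose start i dominator)
    answer i with vertex i
    ... | new    = ignore-H {zero} refl
    ... | oldH y = ignore-H {suc (m ↑ʳ y)} (JH.β-↑ʳ y)
    -- The board of `H` is untouched and `u` is free, so the invariant of `opening` holds, with `f`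
    -- supplying Staller's plan on `G`.
    ... | oldG x = opening (unchosen-after start dominator (punchInᵢ≢i u x ∘ sym) (lookup-replicate u nothing))
                     (f (punchIn u x) (lookup-replicate (punchIn u x) nothing))
                     (JG.reads-chooseˡ JG.start-reads dominator (JG.β-↑ˡ x))
                     (lookup-replicate v nothing) (strategy⇒plan staller t)

neutral : (H : Graph (suc n)) (v : Fin (suc n)) →
          HasOutcome H 𝒩 → HasOutcome (delete H v) 𝒟 → Neutral H v
neutral H v oH oH∖v m G u =
  outcome-unique K (outcome K) (outcome G) (outcome-correct K) (preserved (outcome G) (outcome-correct G))
  where
  open Glued G u H v
  preserved : ∀ o → HasOutcome G o → HasOutcome K o
  preserved 𝒟 s q         = dominator-wins q (s q) (oH∖v staller)
  preserved 𝒮 s dominator = staller-wins-second (s dominator) (oH staller)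
  preserved 𝒮 s staller   = staller-wins-first (s staller) (oH staller)
  preserved 𝒩 s dominator = dominator-wins dominator (s dominator) (oH∖v staller)
  preserved 𝒩 s staller   = staller-wins-first (s staller) (oH staller)

-- Necessity: gluing a point and an edge.

point : Graph 1
point = record { adj = λ _ _ → false ; adj-sym = λ _ _ → refl ; adj-irrefl = λ _ → refl }

edge : Graph 2
edge = record
  { adj        = λ { zero zero → false ; zero (suc _) → true ; (suc _) zero → true ; (suc _) (suc _) → false }
  ; adj-sym    = λ { zero zero → refl ; zero (suc _) → refl ; (suc _) zero → refl ; (suc _) (suc _) → refl }
  ; adj-irrefl = λ { zero → refl ; (suc _) → refl }
  }

-- Here `K` is `H` with `v` renumbered as `zero`. Strategies are carried over by combining the board
-- of `H` with an empty board.
module WithPoint (H : Graph (suc n)) (v : Fin (suc n)) where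

  open Glued point zero H v using (K; module SH)

  module J = Junction (inj₂ v) (id {A = Fin 0}) (punchIn v) id (punchIn-injective v _ _)
    (fresh-inj₂ v _)

  J-located : ∀ {g h} → J.Located g h
  J-located .J.locate (inj₂ y) _ with view v y
  ... | same    = zero , refl
  ... | other x = suc x , refl

  wins : ∀ p {g h c} → J.Reads g h c → ⊤ → Wins H p h → Wins K p c
  wins dominator {h = h} {c} r _ dom zero    =
    SH.lift-new c h (J.lookup-value r ∘ suc) (J.lookup-value r zero) (dom v)
  wins dominator {h = h} {c} r _ dom (suc x) =
    SH.lift-old c h (J.lookup-value r ∘ suc) (J.lookup-value r zero) x (dom (punchIn v x))
  wins staller   {h = h} {c} r _ ¬dom dom = ¬dom dominated
    where
    dominated : Dominating H (ChosenBy dominator h)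
    dominated y with view v y
    ... | other x = SH.restrict-old c h (J.lookup-value r ∘ suc) (trans (sym (J.lookup-value r zero))) x (dom (suc x))
    ... | same with dom zero
    ...   | zero  , cy , _      = v , trans (sym (J.lookup-value r zero)) cy , inj₁ refl
    ...   | suc x , cy , inj₂ a = punchIn v x , trans (sym (J.lookup-value r (suc x))) cy ,
                                  inj₂ (trans (sym (SH.adj-new′ x)) a)

  transfer : ∀ p q → WinningStrategy H p q start → WinningStrategy K p q start
  transfer p q s = subst (λ q → WinningStrategy K p q start) (turn-role p q)
                     (plan⇒strategy (play (role p q) (strategy⇒plan p s)))
    where
    play : ∀ r → Plan (Wins H p) p r start → Plan (Wins K p) p r start
    play mine   s = J.combineʳ (wins p) J-located J.start-reads (idle _ [] refl) s
    play theirs s = J.combine (wins p) J-located J.start-reads (idle _ [] refl) s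

  transfer-outcome : ∀ o → HasOutcome H o → HasOutcome K o
  transfer-outcome 𝒟 s q = transfer dominator q (s q)
  transfer-outcome 𝒮 s q = transfer staller q (s q)
  transfer-outcome 𝒩 s q = transfer q q (s q)

neutral⇒𝒩 : (H : Graph (suc n)) (v : Fin (suc n)) → Neutral H v → outcome H ≡ 𝒩
neutral⇒𝒩 H v neut =
  trans (outcome-unique _ _ _ (WithPoint.transfer-outcome H v _ (outcome-correct H))
                              (outcome-correct (glue point zero H v)))
        -- `outcome point` evaluates to `𝒩`.
        (neut 0 point zero)

module WithEdge (H : Graph (suc n)) (v : Fin (suc n)) where

  open Glued edge zero H v using (K; module SH; module JD; JD-located)

  leaf : Fin (suc (suc n))
  leaf = suc zero

  -- The shape is that of two uses of `remember` on top of `idle`.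
  Isolated : Position (suc (suc n)) → Set
  Isolated c = (⊤ × ChosenBy staller c zero) × ChosenBy staller c leaf

  isolated⇒wins : ∀ c → Isolated c → Wins K staller c
  isolated⇒wins c ((_ , c0) , c1) dom with dom leaf
  ... | zero        , cy , _       with () ← trans (sym c0) cy
  ... | suc zero    , cy , _       with () ← trans (sym c1) cy
  ... | suc (suc _) , _  , inj₁ ()
  ... | suc (suc _) , _  , inj₂ ()

  -- Once Staller owns the glued vertex, the rest of `H` can only be dominated from within. The
  -- board of the edge merely records this ownership.
  undominated-rest : ∀ {g h c} → JD.Reads g h c → ChosenBy staller g zero →
                     Wins (delete H v) staller h → Wins K staller c
  undominated-rest {h = h} {c} r g0 ¬dom dom =
    ¬dom λ x → SH.restrict-delete c h (λ y → JD.reads-at r (JD.β-↑ʳ y))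
                 (trans (JD.lookup-value r zero) g0) x (dom (suc (suc x)))

  staller-wins : WinningStrategy (delete H v) staller staller start →
                 WinningStrategy K staller staller start
  staller-wins s = plan⇒strategy
    (move zero refl (reply (λ full → contradiction refl (full leaf)) answer))
    where
    answer : ∀ i → Unchosen (choose start zero staller) i →
             Plan (Wins K staller) staller mine (choose (choose start zero staller) i dominator)
    -- Both vertices of the edge are now chosen, and Staller is on move on an empty `delete H v`.
    answer (suc zero) _ =
      JD.combineʳ undominated-rest JD-located r
        (full-plan {W = λ g → ChosenBy staller g zero} theirs
          (λ { zero () ; (suc zero) () }) refl)
        (strategy⇒plan staller s)
      where
      r : JD.Reads (just staller ∷ just dominator ∷ []) start (just staller ∷ just dominator ∷ start)
      r .JD.lookup-value zero          = refl
      r .JD.lookup-value (suc zero)    = refl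
      r .JD.lookup-value (suc (suc j)) = refl
    -- Dominator has left the leaf free: taking it decides the game, and Staller may idle
    -- afterwards.
    answer (suc (suc j)) _ =
      move leaf refl (map-plan isolated⇒wins (remember {x = leaf} refl (remember {x = zero} refl (idle _ _ refl))))

-- A win for Dominator as second player already gives `𝒟`, so by determinacy it suffices to refute a
-- win for Staller moving first on `delete H v`.
neutral⇒𝒟 : (H : Graph (suc n)) (v : Fin (suc n)) → Neutral H v → outcome (delete H v) ≡ 𝒟
neutral⇒𝒟 H v neut = [ dominator-case , ⊥-elim ∘ staller-case ]′ (determined (delete H v) _ staller start refl)
  where
  K = glue edge zero H v

  dominator-case : WinningStrategy (delete H v) dominator staller start → outcome (delete H v) ≡ 𝒟
  dominator-case s = outcome-unique _ _ 𝒟 (outcome-correct (delete H v))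
    λ { dominator → extra-move (delete H v) s ; staller → s }

  staller-case : ¬ WinningStrategy (delete H v) staller staller start
  -- `outcome edge` evaluates to `𝒟`, so neutrality gives Dominator a win on `K` with Staller moving
  -- first.
  staller-case s = not-both K (subst (HasOutcome K) (neut 1 edge zero) (outcome-correct K) staller)
                              (WithEdge.staller-wins H v s)

theorem7 : ∀ {n : ℕ} (H : Graph (suc n)) (v : Fin (suc n)) →
    Neutral H v ⇔ (outcome H ≡ 𝒩 × outcome (delete H v) ≡ 𝒟)
theorem7 H v = mk⇔
  (λ neut → neutral⇒𝒩 H v neut , neutral⇒𝒟 H v neut)
  (λ (oH , oH∖v) → neutral H v (subst (HasOutcome H) oH (outcome-correct H))
                               (subst (HasOutcome (delete H v)) oH∖v (outcome-correct (delete H v))))
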